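{- There exists an open and dense set $U\subseteq(0,1)$ such that $\#T(\alpha)>0$ for all $\alpha\in U$.
   Context: $\mathbb{N}$ is the set of positive integers; $\lfloor x\rfloor$ is the integer part (floor) of $x$. For $X\subseteq\mathbb{N}$, $T(X)$ is the set of all tuples $(k,\ell,m)\in\mathbb{N}^3$ with $k\leq \ell\leq m$ such that all of $k,\ \ell,\ m,\ k+\ell,\ \ell+m,\ m+k,\ k+\ell+m$ belong to $X$. For $\alpha>0$, let $S(\alpha)=\{\lfloor \alpha n^2\rfloor : n\in\mathbb{N},\ n\geq \alpha^{ -1/2}\}$ and $T(\alpha)=T(S(\alpha))$. -}

module Defs where

open import Level using (0ℓ; _⊔_)
open import Data.Empty using (⊥)
open import Data.Fin.Base using (Fin)
open import Data.Integer.Base as ℤ using (ℤ; +_)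
import Data.Nat.Base as ℕ
open ℕ using (ℕ)
open import Data.Product.Base using (Σ-syntax; ∃-syntax; _×_; _,_; proj₁; proj₂)
open import Data.Rational.Base hiding (_⊔_)
open import Data.Rational.Literals using (fromℤ)
open import Data.Rational.Properties
open import Data.Sum.Base using (_⊎_; inj₁; inj₂)
import Data.Sum.Base as Sum
open import Function.Definitions using (Injective)
open import Relation.Binary.Definitions using (tri<; tri≈; tri>)
open import Relation.Binary.PropositionalEquality
  using (_≡_; refl; sym; trans; cong; subst; subst₂)
open import Relation.Nullary.Decidable.Core using (yes; no)
open import Relation.Unary using (Pred; _∈_; _⊆_)

-- Two-sided Dedekind cuts: `L q` reads "q < x" and `U q` reads "x < q".
record ℝ : Set₁ where
  field
    L U         : Pred ℚ 0ℓ
    L-inhabited : ∃[ q ] L q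
    U-inhabited : ∃[ q ] U q
    L-down      : ∀ {p q} → p < q → L q → L p
    L-open      : ∀ {p} → L p → ∃[ q ] (p < q × L q)
    U-up        : ∀ {p q} → p < q → U p → U q
    U-open      : ∀ {q} → U q → ∃[ p ] (p < q × U p)
    disjoint    : ∀ {q} → L q → U q → ⊥
    located     : ∀ {p q} → p < q → L p ⊎ U q

open ℝ

infix 4 _<ᴿ_ _≤ᴿ_

_<ᴿ_ : ℝ → ℝ → Set
x <ᴿ y = ∃[ q ] (U x q × L y q)

_≤ᴿ_ : ℝ → ℝ → Set
x ≤ᴿ y = L x ⊆ L y

L<U : ∀ x {p q} → L x p → U x q → p < q
L<U x {p} {q} Lp Uq with <-cmp p q
... | tri< p<q _ _ = p<q
... | tri≈ _ refl _ with () ← disjoint x Lp Uq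
... | tri> _ _ q<p with () ← disjoint x (L-down x q<p Lp) Uq

private
  p<p+1 : ∀ p → p < p + 1ℚ
  p<p+1 p = subst (_< p + 1ℚ) (+-identityʳ p) (+-monoʳ-< p (positive⁻¹ 1ℚ))

  p-1<p : ∀ p → p - 1ℚ < p
  p-1<p p = subst (p - 1ℚ <_) (+-identityʳ p) (+-monoʳ-< p (negative⁻¹ (- 1ℚ)))

  recip : ∀ {p} → 0ℚ < p → ∃[ q ] (0ℚ < q × p * q ≡ 1ℚ)
  recip {p} 0<p = 1/ p , positive⁻¹ (1/ p) , *-inverseʳ p
    where instance
      _ = positive 0<p
      _ = pos⇒nonZero p
      _ = 1/pos⇒pos p

  *-monoʳ-< : ∀ {r p q} → 0ℚ < r → p < q → r * p < r * q
  *-monoʳ-< {r} 0<r = *-monoʳ-<-pos r {{positive 0<r}}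

  *-monoʳ-≤ : ∀ {r p q} → 0ℚ ≤ r → p ≤ q → r * p ≤ r * q
  *-monoʳ-≤ {r} 0≤r = *-monoˡ-≤-nonNeg r {{nonNegative 0≤r}}

  *-monoˡ-≤ : ∀ {r p q} → 0ℚ ≤ r → p ≤ q → p * r ≤ q * r
  *-monoˡ-≤ {r} 0≤r = *-monoʳ-≤-nonNeg r {{nonNegative 0≤r}}

  *-pos : ∀ {p q} → 0ℚ < p → 0ℚ < q → 0ℚ < p * q
  *-pos {p} {q} 0<p 0<q =
    positive⁻¹ (p * q) {{pos*pos⇒pos p {{positive 0<p}} q {{positive 0<q}}}}

  square-mono-< : ∀ {p q} → 0ℚ < p → p < q → p * p < q * q
  square-mono-< {p} {q} 0<p p<q = <-trans (*-monoʳ-< 0<p p<q)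
    (subst (_< q * q) (*-comm q p) (*-monoʳ-< (<-trans 0<p p<q) p<q))

  recip-anti : ∀ {p q p′ q′} → 0ℚ < p′ → 0ℚ < q′ →
               p * p′ ≡ 1ℚ → q * q′ ≡ 1ℚ → p < q → q′ < p′
  recip-anti {p} {q} {p′} {q′} 0<p′ 0<q′ pp′ qq′ p<q =
    subst₂ _<_ eq₁ eq₂ (*-monoʳ-< (*-pos 0<q′ 0<p′) p<q)
    where
    eq₁ : (q′ * p′) * p ≡ q′
    eq₁ = trans (*-assoc q′ p′ p)
      (trans (cong (q′ *_) (trans (*-comm p′ p) pp′)) (*-identityʳ q′))
    eq₂ : (q′ * p′) * q ≡ p′
    eq₂ = trans (*-comm (q′ * p′) q) (trans (sym (*-assoc q q′ p′))
      (trans (cong (_* p′) qq′) (*-identityˡ p′)))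

fromℚ : ℚ → ℝ
fromℚ p = record
  { L           = λ q → q < p
  ; U           = λ q → p < q
  ; L-inhabited = p - 1ℚ , p-1<p p
  ; U-inhabited = p + 1ℚ , p<p+1 p
  ; L-down      = <-trans
  ; L-open      = λ q<p → let m , q<m , m<p = <-dense q<p in m , q<m , m<p
  ; U-up        = λ q<r p<q → <-trans p<q q<r
  ; U-open      = λ p<q → let m , p<m , m<q = <-dense p<q in m , m<q , p<m
  ; disjoint    = λ q<p p<q → <-asym q<p p<q
  ; located     = loc
  }
  where
  loc : ∀ {q r} → q < r → q < p ⊎ p < r
  loc {q} q<r with q <? p
  ... | yes q<p = inj₁ q<p
  ... | no  q≮p = inj₂ (≤-<-trans (≮⇒≥ q≮p) q<r)

fromℤᴿ : ℤ → ℝ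
fromℤᴿ z = fromℚ (fromℤ z)

0ᴿ 1ᴿ : ℝ
0ᴿ = fromℚ 0ℚ
1ᴿ = fromℚ 1ℚ

-- Multiplication of a real number by a natural number.
infixr 7 _·_

_·_ : ℕ → ℝ → ℝ
n · x = record
  { L           = λ p → ∃[ r ] (L x r × p < c * r)
  ; U           = λ q → ∃[ r ] (U x r × c * r < q)
  ; L-inhabited = let r , Lr = L-inhabited x in c * r - 1ℚ , r , Lr , p-1<p (c * r)
  ; U-inhabited = let r , Ur = U-inhabited x in c * r + 1ℚ , r , Ur , p<p+1 (c * r)
  ; L-down      = λ p<q (r , Lr , q<cr) → r , Lr , <-trans p<q q<cr
  ; L-open      = λ (r , Lr , p<cr) → let m , p<m , m<cr = <-dense p<cr in
                  m , p<m , r , Lr , m<cr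
  ; U-up        = λ p<q (r , Ur , cr<p) → r , Ur , <-trans cr<p p<q
  ; U-open      = λ (r , Ur , cr<q) → let m , cr<m , m<q = <-dense cr<q in
                  m , m<q , r , Ur , cr<m
  ; disjoint    = λ (r , Lr , q<cr) (r′ , Ur′ , cr′<q) →
                  <-irrefl refl (<-≤-trans (<-trans cr′<q q<cr)
                    (*-monoʳ-≤ (nonNegative⁻¹ c) (<⇒≤ (L<U x Lr Ur′))))
  ; located     = loc n
  }
  where
  c = fromℤ (+ n)
  loc : ∀ k {p q} → p < q → let d = fromℤ (+ k) in
        (∃[ r ] (L x r × p < d * r)) ⊎ (∃[ r ] (U x r × d * r < q))
  loc ℕ.zero {p} {q} p<q with p <? 0ℚ
  ... | yes p<0 = let r , Lr = L-inhabited x in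
                  inj₁ (r , Lr , subst (p <_) (sym (*-zeroˡ r)) p<0)
  ... | no  p≮0 = let r , Ur = U-inhabited x in
                  inj₂ (r , Ur , subst (_< q) (sym (*-zeroˡ r))
                                   (≤-<-trans (≮⇒≥ p≮0) p<q))
  loc (ℕ.suc k) {p} {q} p<q =
    Sum.map (λ Ls → d⁻¹ * s , Ls , subst (p <_) (sym (cancel s)) p<s)
            (λ Ut → d⁻¹ * t , Ut , subst (_< q) (sym (cancel t)) t<q)
            (located x (*-monoʳ-< 0<d⁻¹ s<t))
    where
    d = fromℤ (+ ℕ.suc k)
    d⁻¹×  = recip {d} (positive⁻¹ d)
    d⁻¹   = proj₁ d⁻¹×
    0<d⁻¹ = proj₁ (proj₂ d⁻¹×)
    cancel : ∀ u → d * (d⁻¹ * u) ≡ u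
    cancel u = trans (sym (*-assoc d d⁻¹ u))
      (trans (cong (_* u) (proj₂ (proj₂ d⁻¹×))) (*-identityˡ u))
    s×  = <-dense p<q
    s   = proj₁ s×
    p<s = proj₁ (proj₂ s×)
    t×  = <-dense (proj₂ (proj₂ s×))
    t   = proj₁ t×
    s<t = proj₁ (proj₂ t×)
    t<q = proj₂ (proj₂ t×)

-- The real number x^(-1/2). For s > 0, s < x^(-1/2) iff s²x < 1 iff s²r ≤ 1 for
-- some rational r > x, and dually; the strict inequalities p < s and s < q
-- extend this to all rationals and make both cuts visibly open.
_^-½ : (x : ℝ) → 0ᴿ <ᴿ x → ℝ
(x ^-½) (ε , 0<ε , Lε) = record
  { L           = Lo
  ; U           = Up
  ; L-inhabited = 0ℚ , Lo0
  ; U-inhabited = Up-inhabited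
  ; L-down      = λ p<q (s , q<s , rest) → s , <-trans p<q q<s , rest
  ; L-open      = λ (s , p<s , rest) → let m , p<m , m<s = <-dense p<s in
                  m , p<m , s , m<s , rest
  ; U-up        = λ p<q (s , s<p , rest) → s , <-trans s<p p<q , rest
  ; U-open      = λ (s , s<q , rest) → let m , s<m , m<q = <-dense s<q in
                  m , m<q , s , s<m , rest
  ; disjoint    = dis
  ; located     = loc
  }
  where
  Lo Up : Pred ℚ 0ℓ
  Lo p = ∃[ s ] (p < s × 0ℚ < s × ∃[ r ] (U x r × s * s * r ≤ 1ℚ))
  Up q = ∃[ s ] (s < q × 0ℚ < s × ∃[ r ] (L x r × 1ℚ ≤ s * s * r))

  0<U : ∀ {r} → U x r → 0ℚ < r
  0<U Ur = <-trans 0<ε (L<U x Lε Ur)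

  Lo0 : Lo 0ℚ
  Lo0 = s , 0<s , 0<s , r , Ur , ≤-trans (*-monoʳ-≤ (<⇒≤ (*-pos 0<s 0<s)) (<⇒≤ r<t))
                                         (subst (_≤ 1ℚ) (sym sst≡s) s≤1)
    where
    r = proj₁ (U-inhabited x)
    Ur = proj₂ (U-inhabited x)
    t = r + 1ℚ
    r<t = p<p+1 r
    1≤t : 1ℚ ≤ t
    1≤t = subst (_≤ t) (+-identityˡ 1ℚ) (+-monoˡ-≤ 1ℚ (<⇒≤ (0<U Ur)))
    s× = recip {t} (<-trans (0<U Ur) r<t)
    s = proj₁ s×
    0<s = proj₁ (proj₂ s×)
    st≡1 : s * t ≡ 1ℚ
    st≡1 = trans (*-comm s t) (proj₂ (proj₂ s×))
    sst≡s : s * s * t ≡ s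
    sst≡s = trans (*-assoc s s t) (trans (cong (s *_) st≡1) (*-identityʳ s))
    s≤1 : s ≤ 1ℚ
    s≤1 = subst₂ _≤_ (*-identityʳ s) st≡1 (*-monoʳ-≤ (<⇒≤ 0<s) 1≤t)

  Up-inhabited : ∃[ q ] Up q
  Up-inhabited = s + 1ℚ , s , p<p+1 s , 0<s , ε , Lε ,
    ≤-trans 1≤s (subst₂ _≤_ (*-identityʳ s) (sym (*-assoc s s ε))
                  (*-monoʳ-≤ (<⇒≤ 0<s) 1≤sε))
    where
    δ× = recip 0<ε
    δ = proj₁ δ×
    0<δ = proj₁ (proj₂ δ×)
    s = δ + 1ℚ
    0<s = <-trans 0<δ (p<p+1 δ)
    1≤s : 1ℚ ≤ s
    1≤s = subst (_≤ s) (+-identityˡ 1ℚ) (+-monoˡ-≤ 1ℚ (<⇒≤ 0<δ))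
    1≤sε : 1ℚ ≤ s * ε
    1≤sε = subst (_≤ s * ε) (trans (*-comm δ ε) (proj₂ (proj₂ δ×)))
                 (*-monoˡ-≤ (<⇒≤ 0<ε) (<⇒≤ (p<p+1 δ)))

  dis : ∀ {q} → Lo q → Up q → ⊥
  dis (s , q<s , 0<s , r , Ur , ssr≤1) (s′ , s′<q , 0<s′ , r′ , Lr′ , 1≤s′s′r′) =
    <-irrefl refl (≤-<-trans 1≤s′s′r′ (<-≤-trans
      (<-≤-trans (*-monoʳ-< (*-pos 0<s′ 0<s′) (L<U x Lr′ Ur))
                 (*-monoˡ-≤ (<⇒≤ (0<U Ur)) (<⇒≤ (square-mono-< 0<s′ (<-trans s′<q q<s)))))
      ssr≤1))

  loc₊ : ∀ {p q} → 0ℚ ≤ p → p < q → Lo p ⊎ Up q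
  loc₊ {p} {q} 0≤p p<q =
    Sum.swap (Sum.map
      (λ Lv → t , t<q , 0<t , v , Lv , ≤-reflexive (sym ttv≡1))
      (λ Uu → s , p<s , 0<s , u , Uu , ≤-reflexive ssu≡1)
      (located x (recip-anti 0<u 0<v ssu≡1 ttv≡1 (square-mono-< 0<s s<t))))
    where
    s× = <-dense p<q
    s = proj₁ s×
    p<s = proj₁ (proj₂ s×)
    t× = <-dense (proj₂ (proj₂ s×))
    t = proj₁ t×
    s<t = proj₁ (proj₂ t×)
    t<q = proj₂ (proj₂ t×)
    0<s = ≤-<-trans 0≤p p<s
    0<t = <-trans 0<s s<t
    u× = recip (*-pos 0<s 0<s)
    u = proj₁ u×
    0<u = proj₁ (proj₂ u×)
    ssu≡1 = proj₂ (proj₂ u×)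
    v× = recip (*-pos 0<t 0<t)
    v = proj₁ v×
    0<v = proj₁ (proj₂ v×)
    ttv≡1 = proj₂ (proj₂ v×)

  loc : ∀ {p q} → p < q → Lo p ⊎ Up q
  loc {p} p<q with p <? 0ℚ
  ... | no  p≮0 = loc₊ (≮⇒≥ p≮0) p<q
  ... | yes p<0 = let s , 0<s , rest = Lo0 in inj₁ (s , <-trans p<0 0<s , rest)

-- z = ⌊x⌋, as a relation: the floor is not a computable function on ℝ.
IsFloor : ℤ → ℝ → Set
IsFloor z x = fromℤᴿ z ≤ᴿ x × x <ᴿ fromℤᴿ (z ℤ.+ ℤ.1ℤ)

-- {⌊αn²⌋ : n ≥ 1, n ≥ α^(-1/2)}.
S : (α : ℝ) → 0ᴿ <ᴿ α → Pred ℕ 0ℓ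
S α α>0 k = ∃[ n ] (0 ℕ.< n × (α ^-½) α>0 ≤ᴿ fromℤᴿ (+ n)
                   × IsFloor (+ k) (n ℕ.^ 2 · α))

-- Here ℕ contains 0, so positivity of k, ℓ and m is required separately.
T : Pred ℕ 0ℓ → Pred (ℕ × ℕ × ℕ) 0ℓ
T X (k , ℓ , m) =
    (0 ℕ.< k × 0 ℕ.< ℓ × 0 ℕ.< m)
  × (k ℕ.≤ ℓ × ℓ ℕ.≤ m)
  × (k ∈ X × ℓ ∈ X × m ∈ X)
  × (k ℕ.+ ℓ ∈ X × ℓ ℕ.+ m ∈ X × m ℕ.+ k ∈ X)
  × k ℕ.+ ℓ ℕ.+ m ∈ X

-- # P > c: there are c + 1 distinct elements of P, which may be infinite.
infix 4 #_>_

#_>_ : ∀ {a p} {A : Set a} → Pred A p → ℕ → Set (a ⊔ p)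
#_>_ {A = A} P c = Σ[ f ∈ (Fin (ℕ.suc c) → A) ]
                     (Injective _≡_ _≡_ f × (∀ i → f i ∈ P))

Interval : ℝ → ℝ → Pred ℝ 0ℓ
Interval a b x = a <ᴿ x × x <ᴿ b

Open : Pred ℝ 0ℓ → Set₁
Open V = ∀ {x} → x ∈ V → ∃[ a ] ∃[ b ]
           (x ∈ Interval (fromℚ a) (fromℚ b) × Interval (fromℚ a) (fromℚ b) ⊆ V)

-- Every point of A lies in the closure of V.
DenseIn : Pred ℝ 0ℓ → Pred ℝ 0ℓ → Set₁
DenseIn A V = ∀ {x} → x ∈ A → ∀ W → Open W → x ∈ W → ∃[ y ] (y ∈ W × y ∈ V)

{-# OPTIONS --safe #-}

-- Suppose 2a² + 1 = d² and put c = a²/2 - 1.  Then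
--   a² + a² = d² - 1,   a² + c² = (a²/2)² + 1,   2a² + c² = (a²/2 + 1)².
-- If α = u/v < 1 and v divides a²/2, then α a² = k and α (c² - 1) = m are integers,
-- and the squares of a, a, c, d, a²/2, a²/2, a²/2 + 1, multiplied by α, are
-- k, k, m, 2k, k + m, k + m, 2k + m with either 0 or α < 1 added.  So (k, k, m) lies
-- in T(α), and it still does for all slightly larger α.  By Pell doubling, a can be
-- made divisible by any power of 2, so this works to the right of every dyadic
-- rational u/v in (0,1), and these are dense.
module Submission where

open import Defs
open import Level using (0ℓ)
open import Data.Product using (Σ-syntax; _×_)
open import Relation.Unary using (Pred; _∈_; _⊆_)
open import Data.Empty using (⊥-elim)
open import Data.Fin.Base using (Fin; zero)
open import Data.Integer.Base as ℤ using (+_)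
import Data.Integer.Properties as ℤ
open import Data.Nat.Base as ℕ using (ℕ; zero; suc; z≤n; s≤s)
import Data.Nat.Properties as ℕ
import Data.Nat.Solver as ℕ
open import Data.Product using (∃-syntax; _,_; proj₁; proj₂)
open import Data.Rational.Base
open import Data.Rational.Literals using (fromℤ)
open import Data.Rational.Properties
open import Data.Rational.Solver using (module +-*-Solver)
open import Data.Sum.Base using (inj₁; inj₂)
open import Function.Definitions using (Injective)
open import Relation.Binary.PropositionalEquality
open import Relation.Nullary.Decidable.Core using (yes; no)

open ℝ

-- Natural numbers inside the rationals.

ι : ℕ → ℚ
ι n = fromℤ (+ n)

-- The sum on the right unfolds to an integer over 1; `↥p/↧p≡p` brings the left side to the same
-- form.
ι-homo-+ : ∀ m n → ι (m ℕ.+ n) ≡ ι m + ι n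
ι-homo-+ m n = trans (sym (↥p/↧p≡p (ι (m ℕ.+ n))))
  (cong (_/ 1) (sym (cong₂ ℤ._+_ (ℤ.*-identityʳ (+ m)) (ℤ.*-identityʳ (+ n)))))

ι-homo-* : ∀ m n → ι (m ℕ.* n) ≡ ι m * ι n
ι-homo-* m n = trans (sym (↥p/↧p≡p (ι (m ℕ.* n)))) (cong (_/ 1) (ℤ.pos-* m n))

ι-homo-sq : ∀ n → ι (n ℕ.^ 2) ≡ ι n * ι n
ι-homo-sq n = trans (cong (λ k → ι (n ℕ.* k)) (ℕ.*-identityʳ n)) (ι-homo-* n n)

ι-mono-≤ : ∀ {m n} → m ℕ.≤ n → ι m ≤ ι n
ι-mono-≤ m≤n = *≤* (ℤ.*-monoʳ-≤-nonNeg (+ 1) (ℤ.+≤+ m≤n))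

ι-mono-< : ∀ {m n} → m ℕ.< n → ι m < ι n
ι-mono-< m<n = *<* (ℤ.*-monoʳ-<-pos (+ 1) (ℤ.+<+ m<n))

-- The denominator is at least 1, so the absolute value of the numerator plus 1 exceeds p.
archimedean : ∀ p → ∃[ n ] p < ι n
archimedean p@record{} = suc ℤ.∣ ↥ p ∣ , *<* (begin-strict
  ↥ p ℤ.* + 1                  ≡⟨ ℤ.*-identityʳ (↥ p) ⟩
  ↥ p                          ≤⟨ i≤∣i∣ (↥ p) ⟩
  + ℤ.∣ ↥ p ∣                  <⟨ ℤ.+<+ ℕ.≤-refl ⟩
  + suc ℤ.∣ ↥ p ∣              ≤⟨ ℤ.+≤+ (ℕ.m≤m*n (suc ℤ.∣ ↥ p ∣) (↧ₙ p)) ⟩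
  + (suc ℤ.∣ ↥ p ∣ ℕ.* ↧ₙ p)   ≡⟨ ℤ.pos-* (suc ℤ.∣ ↥ p ∣) (↧ₙ p) ⟩
  + suc ℤ.∣ ↥ p ∣ ℤ.* ↧ p      ∎)
  where
  open ℤ.≤-Reasoning
  i≤∣i∣ : ∀ i → i ℤ.≤ + ℤ.∣ i ∣
  i≤∣i∣ (+ _)      = ℤ.≤-refl
  i≤∣i∣ (ℤ.-[1+ _ ]) = ℤ.-≤+

ι-floor : ∀ {p} → 0ℚ ≤ p → ∃[ n ] (p < ι (suc n) × ι n ≤ p)
ι-floor {p} 0≤p = let n , p<n = archimedean p in search n p<n
  where
  search : ∀ n → p < ι n → ∃[ m ] (p < ι (suc m) × ι m ≤ p)
  search zero    p<0   = ⊥-elim (<-irrefl refl (≤-<-trans 0≤p p<0))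
  search (suc n) p<1+n with p <? ι n
  ... | yes p<n = search n p<n
  ... | no  p≮n = n , p<1+n , ≮⇒≥ p≮n

-- Density of the dyadic rationals.

n<2^n : ∀ n → n ℕ.< 2 ℕ.^ n
n<2^n zero    = s≤s z≤n
n<2^n (suc n) = begin
  2 ℕ.+ n                ≡⟨ ℕ.+-comm 1 (suc n) ⟩
  suc n ℕ.+ 1            ≤⟨ ℕ.+-mono-≤ (n<2^n n) (ℕ.m^n>0 2 n) ⟩
  2 ℕ.^ n ℕ.+ 2 ℕ.^ n    ≡⟨ cong (2 ℕ.^ n ℕ.+_) (sym (ℕ.+-identityʳ (2 ℕ.^ n))) ⟩
  2 ℕ.^ suc n            ∎
  where open ℕ.≤-Reasoning

p<q⇒0<q-p : ∀ {p q} → p < q → 0ℚ < q - p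
p<q⇒0<q-p {p} {q} p<q = subst (_< q - p) (+-inverseʳ p) (+-monoˡ-< (- p) p<q)

ι-cancelˡ : ∀ n .{{_ : ℕ.NonZero n}} p → ∃[ q ] (ι n * q ≡ p)
ι-cancelˡ n@(suc _) p = 1/ ι n * p ,
  trans (sym (*-assoc (ι n) (1/ ι n) p))
        (trans (cong (_* p) (*-inverseʳ (ι n))) (*-identityˡ p))

-- A denominator v = 2^(n+1) above 1/(q - p) makes v q - v p exceed 1, so floor(v p) + 1 lies
-- strictly between. The exponent `suc j` keeps v even and `suc u` keeps the numerator positive;
-- both are used later.
dyadics-dense : ∀ {p q} → 0ℚ ≤ p → p < q → ∃[ j ] ∃[ u ] ∃[ y ]
                (p < y × y < q × ι (2 ℕ.^ suc j) * y ≡ ι (suc u))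
dyadics-dense {p} {q} 0≤p p<q = n , u , y ,
    cancel (subst (ι v * p <_) (sym vy≡u) vp<u) ,
    cancel (subst (_< ι v * q) (sym vy≡u) u<vq) ,
    vy≡u
  where
  0<d = p<q⇒0<q-p p<q
  instance
    d>0 = positive 0<d
    d≢0 = pos⇒nonZero (q - p)
  n×  = archimedean (1/ (q - p))
  n   = proj₁ n×
  v   = 2 ℕ.^ suc n
  instance
    v≢0 = ℕ.m^n≢0 2 (suc n)
  cancel : ∀ {r s} → ι v * r < ι v * s → r < s
  cancel = *-cancelˡ-<-nonNeg (ι v)
  1<vd : 1ℚ < ι v * (q - p)
  1<vd = begin-strict
    1ℚ                     ≡⟨ sym (*-inverseˡ (q - p)) ⟩
    1/ (q - p) * (q - p)   <⟨ *-monoˡ-<-pos (q - p) (proj₂ n×) ⟩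
    ι n * (q - p)          ≤⟨ *-monoʳ-≤-nonNeg (q - p) {{pos⇒nonNeg (q - p)}} (ι-mono-≤ n≤v) ⟩
    ι v * (q - p)          ∎
    where
    open ≤-Reasoning
    n≤v : n ℕ.≤ v
    n≤v = ℕ.≤-trans (ℕ.n≤1+n n) (ℕ.<⇒≤ (n<2^n (suc n)))
  u×  = ι-floor {ι v * p} (subst (_≤ ι v * p) (*-zeroʳ (ι v)) (*-monoˡ-≤-nonNeg (ι v) 0≤p))
  u   = proj₁ u×
  vp<u = proj₁ (proj₂ u×)
  u<vq : ι (suc u) < ι v * q
  u<vq = begin-strict
    ι (suc u)                    ≡⟨ ι-homo-+ 1 u ⟩
    1ℚ + ι u                     <⟨ +-mono-<-≤ 1<vd (proj₂ (proj₂ u×)) ⟩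
    ι v * (q - p) + ι v * p      ≡⟨ solve 3 (λ v p q → v :* (q :- p) :+ v :* p := v :* q) refl (ι v) p q ⟩
    ι v * q                      ∎
    where
    open ≤-Reasoning
    open +-*-Solver
  y×  = ι-cancelˡ v (ι (suc u))
  y   = proj₁ y×
  vy≡u = proj₂ y×

-- Certifying floors from rational bounds on α.

Box : ℚ → ℚ → Pred ℕ 0ℓ
Box p q k = ∃[ n ] (0 ℕ.< k × 0 ℕ.< n × ι k ≤ ι (n ℕ.^ 2) * p × ι (n ℕ.^ 2) * q ≤ ι (k ℕ.+ 1))

T-mono : ∀ {X Y} → X ⊆ Y → T X ⊆ T Y
T-mono f (pos , ord , (k , l , m) , (kl , lm , mk) , klm) =
  pos , ord , (f k , f l , f m) , (f kl , f lm , f mk) , f klm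

-- Bounds at p and q fix the floor of n² α for every α strictly between them. Since k > 0, also 1 ≤
-- k ≤ n² p < n² α, which yields n ≥ α^(-1/2).
Box⊆S : ∀ {p q} α (α>0 : 0ᴿ <ᴿ α) → L α p → U α q → Box p q ⊆ S α α>0
Box⊆S {p} {q} α α>0 Lp Uq {k} (n , 0<k , 0<n , k≤n²p , n²q≤k+1) =
  n , 0<n , (α^-½≤n) , (λ s<k → p , Lp , <-≤-trans s<k k≤n²p) , n²α<k+1
  where
  n² = ι (n ℕ.^ 2)
  instance
    n²>0 : Positive n²
    n²>0 = positive (ι-mono-< (ℕ.m^n>0 n {{ℕ.>-nonZero 0<n}} 2))
    n²≥0 = pos⇒nonNeg n²
  α^-½≤n : (α ^-½) α>0 ≤ᴿ fromℤᴿ (+ n)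
  α^-½≤n {s} (t , s<t , 0<t , r , Ur , t²r≤1) with ι n <? t
  ... | no  n≮t = <-≤-trans s<t (≮⇒≥ n≮t)
  ... | yes n<t = ⊥-elim (<-irrefl refl (begin-strict
    1ℚ               ≤⟨ ι-mono-≤ 0<k ⟩
    ι k              ≤⟨ k≤n²p ⟩
    n² * p           <⟨ *-monoʳ-<-pos n² p<r ⟩
    n² * r           ≡⟨ cong (_* r) (ι-homo-sq n) ⟩
    ι n * ι n * r    ≤⟨ *-monoʳ-≤-nonNeg r (*-monoˡ-≤-nonNeg (ι n) (<⇒≤ n<t)) ⟩
    ι n * t * r      ≤⟨ *-monoʳ-≤-nonNeg r (*-monoʳ-≤-nonNeg t {{nonNegative (<⇒≤ 0<t)}} (<⇒≤ n<t)) ⟩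
    t * t * r        ≤⟨ t²r≤1 ⟩
    1ℚ               ∎))
    where
    open ≤-Reasoning
    p<r = L<U α Lp Ur
    instance
      r≥0 : NonNegative r
      r≥0 = nonNegative (<⇒≤ (<-trans (proj₁ (proj₂ α>0)) (L<U α (proj₂ (proj₂ α>0)) Ur)))
  n²α<k+1 : (n ℕ.^ 2) · α <ᴿ fromℤᴿ (+ (k ℕ.+ 1))
  n²α<k+1 =
    -- Lowering the upper bound from q to r makes room for a strict inequality.
    let r , r<q , Ur = U-open α Uq
        c , n²r<c , c<k+1 = <-dense (<-≤-trans (*-monoʳ-<-pos n² r<q) n²q≤k+1)
    in c , (r , Ur , n²r<c) , c<k+1

-- Intervals to the right of a rational y.

Good : ℚ → ℚ → Set
Good p q = ∃[ t ] t ∈ T (Box p q)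

-- n² = vs + δ and v y = u give n² y = su + δ y, so n² α stays in [su, su + 1) as
-- long as α exceeds y by less than (1 - y)/n².
module Above {y : ℚ} (v u M : ℕ)
             (0≤y : 0ℚ ≤ y) (y<1 : y < 1ℚ) (vy≡u : ι v * y ≡ ι (suc u)) where

  private
    -- `N` bounds every n² = δ + v s with δ ≤ 1 and s ≤ M, so g = (1 - y)/N gives n² g ≤ 1 - y.
    N  = suc (v ℕ.* M)
    g× = ι-cancelˡ N (1ℚ - y)
    g  = proj₁ g×

    0<g : 0ℚ < g
    0<g = *-cancelˡ-<-nonNeg (ι N) (subst₂ _<_ (sym (*-zeroʳ (ι N))) (sym (proj₂ g×)) (p<q⇒0<q-p y<1))

    n*g≤1-y : ∀ {n} → n ℕ.≤ N → ι n * g ≤ 1ℚ - y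
    n*g≤1-y {n} n≤N = subst (ι n * g ≤_) (proj₂ g×) (*-monoʳ-≤-nonNeg g {{nonNegative (<⇒≤ 0<g)}} (ι-mono-≤ n≤N))

  upper : ℚ
  upper = y + g

  y<upper : y < upper
  y<upper = subst (_< upper) (+-identityʳ y) (+-monoʳ-< y 0<g)

  upper≤1 : upper ≤ 1ℚ
  upper≤1 = begin
    y + g            ≡⟨ cong (λ x → y + x) (sym (*-identityˡ g)) ⟩
    y + 1ℚ * g       ≤⟨ +-monoʳ-≤ y (n*g≤1-y (s≤s z≤n)) ⟩
    y + (1ℚ - y)     ≡⟨ solve 1 (λ y → y :+ (con 1ℚ :- y) := con 1ℚ) refl y ⟩
    1ℚ               ∎
    where
    open ≤-Reasoning
    open +-*-Solver

  -- Here n² y = s (u + 1) + δ y. Dropping δ y ≥ 0 gives the lower bound; above, δ y ≤ y and n² g ≤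
  -- 1 - y add up to at most 1.
  s*u∈Box : ∀ {n s δ} → n ℕ.^ 2 ≡ δ ℕ.+ v ℕ.* s → δ ℕ.≤ 1 → s ℕ.≤ M → 0 ℕ.< n → 0 ℕ.< s →
        s ℕ.* suc u ∈ Box y upper
  s*u∈Box {n} {s} {δ} n²≡ δ≤1 s≤M 0<n 0<s = n , ℕ.*-mono-≤ 0<s (s≤s z≤n) , 0<n ,
      (begin
        ι su                ≡⟨ sym (+-identityʳ (ι su)) ⟩
        ι su + 0ℚ           ≡⟨ cong (λ x → ι su + x) (sym (*-zeroʳ (ι δ))) ⟩
        ι su + ι δ * 0ℚ     ≤⟨ +-monoʳ-≤ (ι su) (*-monoˡ-≤-nonNeg (ι δ) 0≤y) ⟩
        ι su + ι δ * y      ≡⟨ sym n²y ⟩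
        ι (n ℕ.^ 2) * y     ∎) ,
      (begin
        ι (n ℕ.^ 2) * (y + g)                ≡⟨ *-distribˡ-+ (ι (n ℕ.^ 2)) y g ⟩
        ι (n ℕ.^ 2) * y + ι (n ℕ.^ 2) * g    ≤⟨ +-mono-≤ (≤-reflexive n²y) (n*g≤1-y n²≤N) ⟩
        (ι su + ι δ * y) + (1ℚ - y)          ≤⟨ +-monoˡ-≤ (1ℚ - y) (+-monoʳ-≤ (ι su) (*-monoʳ-≤-nonNeg y {{nonNegative 0≤y}} (ι-mono-≤ δ≤1))) ⟩
        (ι su + 1ℚ * y) + (1ℚ - y)           ≡⟨ solve 2 (λ k y → (k :+ con 1ℚ :* y) :+ (con 1ℚ :- y) := k :+ con 1ℚ) refl (ι su) y ⟩
        ι su + 1ℚ                            ≡⟨ sym (ι-homo-+ su 1) ⟩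
        ι (su ℕ.+ 1)                         ∎)
    where
    open ≤-Reasoning
    open +-*-Solver
    su = s ℕ.* suc u
    n²≤N : n ℕ.^ 2 ℕ.≤ N
    n²≤N = subst (ℕ._≤ N) (sym n²≡) (ℕ.+-mono-≤ δ≤1 (ℕ.*-monoʳ-≤ v s≤M))
    n²y : ι (n ℕ.^ 2) * y ≡ ι su + ι δ * y
    n²y = begin-equality
      ι (n ℕ.^ 2) * y                ≡⟨ cong (λ m → ι m * y) n²≡ ⟩
      ι (δ ℕ.+ v ℕ.* s) * y          ≡⟨ cong (_* y) (trans (ι-homo-+ δ (v ℕ.* s)) (cong (λ x → ι δ + x) (ι-homo-* v s))) ⟩
      (ι δ + ι v * ι s) * y          ≡⟨ solve 4 (λ v s δ y → (δ :+ v :* s) :* y := s :* (v :* y) :+ δ :* y) refl (ι v) (ι s) (ι δ) y ⟩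
      ι s * (ι v * y) + ι δ * y      ≡⟨ cong (λ x → ι s * x + ι δ * y) vy≡u ⟩
      ι s * ι (suc u) + ι δ * y      ≡⟨ cong (_+ ι δ * y) (sym (ι-homo-* s (suc u))) ⟩
      ι su + ι δ * y                 ∎

-- Pell's equation and the triple.

-- Doubling (d + a√2)² = d² + 2a² + 2ad √2 in ℤ[√2] gains a factor 2 in a.
pell : ∀ j → ∃[ b ] ∃[ d ] (0 ℕ.< b × 0 ℕ.< d × d ℕ.^ 2 ≡ 1 ℕ.+ 2 ℕ.* (2 ℕ.* 2 ℕ.^ j ℕ.* b) ℕ.^ 2)
pell zero    = 1 , 3 , s≤s z≤n , s≤s z≤n , refl
pell (suc j) = let b , d , 0<b , 0<d , d²≡ = pell j in
  -- As d² = 1 + 2a², the new d² + 2a² is 1 + 4a²; the new 2ad has the required form with `b * d`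
  -- for b.
  b ℕ.* d , 1 ℕ.+ 4 ℕ.* (2 ℕ.* v ℕ.* b) ℕ.^ 2 , ℕ.*-mono-≤ 0<b 0<d , s≤s z≤n , (begin
    (1 ℕ.+ 4 ℕ.* (2 ℕ.* v ℕ.* b) ℕ.^ 2) ℕ.^ 2
      ≡⟨ solve 2 (λ v b → let a² = (con 2 :* v :* b) :^ 2 in
           (con 1 :+ con 4 :* a²) :^ 2 := con 1 :+ con 8 :* a² :* (con 1 :+ con 2 :* a²)) refl v b ⟩
    1 ℕ.+ 8 ℕ.* (2 ℕ.* v ℕ.* b) ℕ.^ 2 ℕ.* (1 ℕ.+ 2 ℕ.* (2 ℕ.* v ℕ.* b) ℕ.^ 2)
      ≡⟨ cong (λ x → 1 ℕ.+ 8 ℕ.* (2 ℕ.* v ℕ.* b) ℕ.^ 2 ℕ.* x) (sym d²≡) ⟩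
    1 ℕ.+ 8 ℕ.* (2 ℕ.* v ℕ.* b) ℕ.^ 2 ℕ.* d ℕ.^ 2
      ≡⟨ solve 3 (λ v b d → con 1 :+ con 8 :* (con 2 :* v :* b) :^ 2 :* d :^ 2 :=
           con 1 :+ con 2 :* (con 2 :* (con 2 :* v) :* (b :* d)) :^ 2) refl v b d ⟩
    1 ℕ.+ 2 ℕ.* (2 ℕ.* (2 ℕ.* v) ℕ.* (b ℕ.* d)) ℕ.^ 2 ∎)
  where
  open ≡-Reasoning
  open ℕ.+-*-Solver
  v = 2 ℕ.^ j

-- The interval extends only to the right of y: a² and (a²/2)² are exact multiples of v, so their
-- floors drop below y.
good-above : ∀ {y} j u → 0ℚ ≤ y → y < 1ℚ → ι (2 ℕ.^ suc j) * y ≡ ι (suc u) →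
             ∃[ z ] (y < z × z ≤ 1ℚ × Good y z)
good-above {y} j u 0≤y y<1 vy≡u =
    upper , y<upper , upper≤1 , (A ℕ.* suc u , A ℕ.* suc u , C ℕ.* suc u) ,
    (0<su 0<A , 0<su 0<A , 0<su 0<C) ,
    (ℕ.≤-refl , ℕ.*-monoˡ-≤ (suc u) A≤C) ,
    (a∈ , a∈ , c∈) ,
    (sum A A d∈ , sum A C f∈ , sum C A (subst (λ s → s ℕ.* suc u ∈ X) (ℕ.+-comm A C) f∈)) ,
    subst (λ s → s ℕ.+ C ℕ.* suc u ∈ X) (ℕ.*-distribʳ-+ (suc u) A A) (sum (A ℕ.+ A) C h∈)
  where
  -- Here α is close to suc u / v, a²/2 = v w, c = suc e, k = A * suc u and m = C * suc u.
  open ℕ.+-*-Solver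
  v = 2 ℕ.^ suc j
  -- With this exponent a = 2 v b, hence a²/2 = v w for w = 2 v b².
  pell× = pell (suc j)
  b   = proj₁ pell×
  d   = proj₁ (proj₂ pell×)
  0<b = proj₁ (proj₂ (proj₂ pell×))
  0<d = proj₁ (proj₂ (proj₂ (proj₂ pell×)))
  d²≡1+2a² = proj₂ (proj₂ (proj₂ (proj₂ pell×)))
  a = 2 ℕ.* v ℕ.* b
  w = 2 ℕ.* v ℕ.* b ℕ.^ 2
  2≤v : 2 ℕ.≤ v
  2≤v = ℕ.*-monoʳ-≤ 2 (ℕ.m^n>0 2 j)
  0<b² : 0 ℕ.< b ℕ.^ 2
  0<b² = ℕ.m^n>0 b {{ℕ.>-nonZero 0<b}} 2
  4≤w : 4 ℕ.≤ w
  4≤w = ℕ.*-mono-≤ (ℕ.*-monoʳ-≤ 2 2≤v) 0<b²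
  8≤vw : 8 ℕ.≤ v ℕ.* w
  8≤vw = ℕ.*-mono-≤ 2≤v 4≤w
  -- For c = `suc e` = v w - 1, c² - 1 = e (e + 2) = v w e is a multiple of v. The subtraction is
  -- exact because v w ≥ 8.
  e = v ℕ.* w ℕ.∸ 2
  vw≡ : v ℕ.* w ≡ 2 ℕ.+ e
  vw≡ = sym (ℕ.m+[n∸m]≡n (ℕ.≤-trans (s≤s (s≤s z≤n)) 8≤vw))
  2≤e : 2 ℕ.≤ e
  2≤e = ℕ.≤-trans (s≤s (s≤s z≤n)) (ℕ.∸-monoˡ-≤ 2 8≤vw)
  -- These are a²/v and (c² - 1)/v; e ≥ 2 puts them in order.
  A = w ℕ.+ w
  C = w ℕ.* e
  0<A : 0 ℕ.< A
  0<A = ℕ.≤-trans (s≤s z≤n) (ℕ.≤-trans 4≤w (ℕ.m≤m+n w w))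
  A≤C : A ℕ.≤ C
  A≤C = subst (ℕ._≤ C) (solve 1 (λ w → w :* con 2 := w :+ w) refl w) (ℕ.*-monoʳ-≤ w 2≤e)
  0<C : 0 ℕ.< C
  0<C = ℕ.≤-trans 0<A A≤C
  0<su : ∀ {s} → 0 ℕ.< s → 0 ℕ.< s ℕ.* suc u
  0<su 0<s = ℕ.*-mono-≤ 0<s (s≤s z≤n)

  -- The largest multiplier s is A + A + C, so one `upper` serves the triple and all its sums.
  open Above v u (A ℕ.+ A ℕ.+ C) 0≤y y<1 vy≡u
  X = Box y upper

  a²≡ : a ℕ.^ 2 ≡ 0 ℕ.+ v ℕ.* A
  a²≡ = solve 2 (λ v b → let w = con 2 :* v :* b :^ 2 in
          (con 2 :* v :* b) :^ 2 := v :* (w :+ w)) refl v b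
  c²≡ : suc e ℕ.^ 2 ≡ 1 ℕ.+ v ℕ.* C
  c²≡ = trans (solve 1 (λ e → (con 1 :+ e) :^ 2 := con 1 :+ (con 2 :+ e) :* e) refl e)
       (trans (cong (λ x → 1 ℕ.+ x ℕ.* e) (sym vw≡)) (cong suc (ℕ.*-assoc v w e)))
  d²≡ : d ℕ.^ 2 ≡ 1 ℕ.+ v ℕ.* (A ℕ.+ A)
  d²≡ = trans d²≡1+2a² (trans (cong (λ x → 1 ℕ.+ 2 ℕ.* x) a²≡)
          (solve 2 (λ v A → con 1 :+ con 2 :* (v :* A) := con 1 :+ v :* (A :+ A)) refl v A))
  f²≡ : (v ℕ.* w) ℕ.^ 2 ≡ 0 ℕ.+ v ℕ.* (A ℕ.+ C)
  -- Rewriting just one factor v w as 2 + e leaves the other to supply the factor v.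
  f²≡ = trans (cong (λ x → v ℕ.* w ℕ.* (x ℕ.* 1)) vw≡)
          (solve 3 (λ v w e → v :* w :* ((con 2 :+ e) :* con 1) := v :* (w :+ w :+ w :* e)) refl v w e)
  h²≡ : suc (v ℕ.* w) ℕ.^ 2 ≡ 1 ℕ.+ v ℕ.* (A ℕ.+ A ℕ.+ C)
  h²≡ = trans (solve 1 (λ x → (con 1 :+ x) :^ 2 := con 1 :+ x :* (con 2 :+ x)) refl (v ℕ.* w))
       (trans (cong (λ x → 1 ℕ.+ v ℕ.* w ℕ.* (2 ℕ.+ x)) vw≡)
          (solve 3 (λ v w e → con 1 :+ v :* w :* (con 2 :+ (con 2 :+ e)) :=
             con 1 :+ v :* (w :+ w :+ (w :+ w) :+ w :* e)) refl v w e))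

  A+A≤ : A ℕ.+ A ℕ.≤ A ℕ.+ A ℕ.+ C
  A+A≤ = ℕ.m≤m+n (A ℕ.+ A) C
  0<vw : 0 ℕ.< v ℕ.* w
  0<vw = ℕ.≤-trans (s≤s z≤n) 8≤vw
  a∈ : A ℕ.* suc u ∈ X
  a∈ = s*u∈Box {a} a²≡ z≤n (ℕ.≤-trans (ℕ.m≤m+n A A) A+A≤) (ℕ.*-mono-≤ (ℕ.m^n>0 2 (suc (suc j))) 0<b) 0<A
  c∈ : C ℕ.* suc u ∈ X
  c∈ = s*u∈Box {suc e} c²≡ ℕ.≤-refl (ℕ.m≤n+m C (A ℕ.+ A)) (s≤s z≤n) 0<C
  d∈ : (A ℕ.+ A) ℕ.* suc u ∈ X
  d∈ = s*u∈Box {d} d²≡ ℕ.≤-refl A+A≤ 0<d (ℕ.≤-trans 0<A (ℕ.m≤m+n A A))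
  f∈ : (A ℕ.+ C) ℕ.* suc u ∈ X
  f∈ = s*u∈Box {v ℕ.* w} f²≡ z≤n (ℕ.+-monoˡ-≤ C (ℕ.m≤m+n A A)) 0<vw (ℕ.≤-trans 0<A (ℕ.m≤m+n A C))
  h∈ : (A ℕ.+ A ℕ.+ C) ℕ.* suc u ∈ X
  h∈ = s*u∈Box {suc (v ℕ.* w)} h²≡ ℕ.≤-refl ℕ.≤-refl (s≤s z≤n) (ℕ.≤-trans 0<C (ℕ.m≤n+m C (A ℕ.+ A)))
  sum : ∀ s t → (s ℕ.+ t) ℕ.* suc u ∈ X → s ℕ.* suc u ℕ.+ t ℕ.* suc u ∈ X
  sum s t = subst X (ℕ.*-distribʳ-+ (suc u) s t)

-- The open dense set.

L-⊔ : ∀ x {p q} → L x p → L x q → L x (p ⊔ q)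
L-⊔ x {p} {q} Lp Lq with ⊔-sel p q
... | inj₁ eq = subst (L x) (sym eq) Lp
... | inj₂ eq = subst (L x) (sym eq) Lq

U-⊓ : ∀ x {p q} → U x p → U x q → U x (p ⊓ q)
U-⊓ x {p} {q} Up Uq with ⊓-sel p q
... | inj₁ eq = subst (U x) (sym eq) Up
... | inj₂ eq = subst (U x) (sym eq) Uq

fromℚ-< : ∀ {p q} → p < q → fromℚ p <ᴿ fromℚ q
fromℚ-< p<q = let r , p<r , r<q = <-dense p<q in r , p<r , r<q

corollary1p3 : Σ[ U ∈ Pred ℝ 0ℓ ]
    ( U ⊆ Interval 0ᴿ 1ᴿ
    × Open U
    × DenseIn (Interval 0ᴿ 1ᴿ) U
    × (∀ α (α>0 : 0ᴿ <ᴿ α) → α ∈ U → # T (S α α>0) > 0) )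
corollary1p3 = V , (λ {x} → V⊆01 {x}) , (λ {x} → V-open {x}) , (λ {x} → V-dense {x}) , V⇒T
  where
  -- Rational brackets, unlike real endpoints, keep the predicate in `Set`; every real in the same
  -- bracket inherits membership, which gives openness.
  V : Pred ℝ 0ℓ
  V x = ∃[ p ] ∃[ q ] (L x p × U x q × 0ℚ ≤ p × q ≤ 1ℚ × Good p q)

  V⊆01 : V ⊆ Interval 0ᴿ 1ᴿ
  V⊆01 {x} (p , q , Lp , Uq , 0≤p , q≤1 , _) =
    let r , p<r , Lr = L-open x Lp
        s , s<q , Us = U-open x Uq
    in (r , ≤-<-trans 0≤p p<r , Lr) , (s , Us , <-≤-trans s<q q≤1)

  V-open : Open V
  V-open {x} (p , q , Lp , Uq , rest) =
    let r , p<r , Lr = L-open x Lp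
        s , s<q , Us = U-open x Uq
    in p , q , ((r , p<r , Lr) , (s , Us , s<q)) ,
       λ {y} ((r , p<r , Lr) , (s , Us , s<q)) → p , q , L-down y p<r Lr , U-up y s<q Us , rest

  V-dense : DenseIn (Interval 0ᴿ 1ᴿ) V
  V-dense {x} ((r₀ , 0<r₀ , Lr₀) , (s₀ , Us₀ , s₀<1)) W W-open x∈W =
    let a , b , ((r , a<r , Lr) , (s , Us , s<b)) , ab⊆W = W-open x∈W
        0≤p = ≤-trans (<⇒≤ 0<r₀) (p≤p⊔q r₀ r)
        -- The bounds r₀ ⊔ r < x < s₀ ⊓ s place the dyadic y in both (0,1) and (a,b).
        j , u , y , p<y , y<q , vy≡u = dyadics-dense 0≤p (L<U x (L-⊔ x Lr₀ Lr) (U-⊓ x Us₀ Us))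
        0≤y = ≤-trans 0≤p (<⇒≤ p<y)
        y<1 = <-trans (<-≤-trans y<q (p⊓q≤p s₀ s)) s₀<1
        z , y<z , z≤1 , good = good-above j u 0≤y y<1 vy≡u
        a<y = <-trans a<r (≤-<-trans (p≤q⊔p r₀ r) p<y)
        y<b = <-trans (<-≤-trans y<q (p⊓q≤q s₀ s)) s<b
        -- `y` is the excluded left endpoint of the good interval, so the point is taken strictly to
        -- its right, below both z and b.
        y′ , y<y′ , y′<z⊓b = <-dense (⊓-lub-< y<z y<b)
    in fromℚ y′ ,
       ab⊆W (fromℚ-< (<-trans a<y y<y′) , fromℚ-< (<-≤-trans y′<z⊓b (p⊓q≤q z b))) ,
       y , z , y<y′ , <-≤-trans y′<z⊓b (p⊓q≤p z b) , 0≤y , z≤1 , good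
    where
    ⊓-lub-< : ∀ {p q r} → p < q → p < r → p < q ⊓ r
    ⊓-lub-< {p} {q} {r} p<q p<r with ⊓-sel q r
    ... | inj₁ eq = subst (p <_) (sym eq) p<q
    ... | inj₂ eq = subst (p <_) (sym eq) p<r

  V⇒T : ∀ α (α>0 : 0ᴿ <ᴿ α) → α ∈ V → # T (S α α>0) > 0
  V⇒T α α>0 (p , q , Lp , Uq , _ , _ , t , t∈T) =
    (λ _ → t) , one ,
    λ _ → T-mono {Box p q} {S α α>0} (Box⊆S α α>0 Lp Uq) t∈T
    where
    one : Injective {A = Fin 1} _≡_ _≡_ (λ _ → t)
    one {zero} {zero} _ = refl
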